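{- For every integer $n\ge 0$, the Fibonacci-Fubini number $\mathcal{F}_n$ is given by $$\mathcal{F}_n = \frac{1}{\sqrt{5}} \sum_{k=0}^{n}\sum_{j=0}^{k}(-1)^{k-j}\binom{k}{j} \frac{\alpha^{k+1}-\beta^{k+1}}{k!}\, j^n .$$
   Context: $\alpha=(1+\sqrt5)/2$ and $\beta=(1-\sqrt5)/2$. Convention: $0^0=1$. A permutation $\sigma=\sigma_1\cdots\sigma_k$ of $\{1,\dots,k\}$ is a Fibonacci permutation if $|\sigma_i-i|\le 1$ for every $i$. For a set partition of $[n]=\{1,\dots,n\}$ into non-empty blocks $B_1|B_2|\cdots|B_k$, the blocks are always listed so that $\min B_1<\min B_2<\cdots<\min B_k$. A Fibonacci ordered partition of $[n]$ is an arrangement $B_{\sigma_1}|B_{\sigma_2}|\cdots|B_{\sigma_k}$ where $B_1|\cdots|B_k$ is a partition of $[n]$ (any number $k$ of blocks) and $\sigma$ is a Fibonacci permutation of $\{1,\dots,k\}$. The Fibonacci-Fubini number $\mathcal{F}_n$ is the total number of Fibonacci ordered partitions of $[n]$ (for $n=0$ the empty partition with $k=0$ blocks is counted once, so $\mathcal{F}_0=1$). -}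

module Defs where

open import Algebra.Bundles.Raw using (RawSemiring)
import Algebra.Definitions.RawSemiring as RawSemiringDefinitions
open import Data.Fin.Base as Fin using (Fin; toℕ)
open import Data.Fin.Permutation using (Permutation′; _⟨$⟩ʳ_)
open import Data.Fin.Subset using (Subset; _∈_; Nonempty)
open import Data.Integer.Base as ℤ using (+_)
open import Data.List.Base using (List; length; tabulate)
import Data.List.Membership.Propositional as List
open import Data.List.Membership.Propositional.Properties.WithK using (unique∧set⇒bag)
open import Data.List.Relation.Binary.BagAndSetEquality using (∼bag⇒↭)
open import Data.List.Relation.Binary.Permutation.Propositional.Properties using (↭-length)
open import Data.List.Relation.Unary.Unique.Propositional using (Unique)
open import Data.Nat.Base as ℕ using (ℕ; suc; ∣_-_∣)
open import Data.Product.Base using (∃-syntax; Σ-syntax; _×_; _,_)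
open import Data.Rational.Base as ℚ using (ℚ; 0ℚ; 1ℚ)
open import Function.Base using (_∘_)
open import Function.Bundles using (_⇔_)
open import Function.Construct.Composition using (_⇔-∘_)
open import Function.Construct.Symmetry using (⇔-sym)
open import Level using (0ℓ)
open import Relation.Binary.PropositionalEquality using (_≡_; refl; trans; sym)

-- The set [n] is represented by Fin n, i.e. shifted down by one.

IsLeast : ∀ {n} → Fin n → Subset n → Set
IsLeast x p = x ∈ p × (∀ {y} → y ∈ p → x Fin.≤ y)

record IsSetPartition {n k : ℕ} (B : Fin k → Subset n) : Set where
  field
    nonempty : ∀ i → Nonempty (B i)
    disjoint : ∀ {i j x} → x ∈ B i → x ∈ B j → i ≡ j
    covering : ∀ x → ∃[ i ] x ∈ B i
    ordered  : ∀ {i j x y} → i Fin.< j →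
               IsLeast x (B i) → IsLeast y (B j) → x Fin.< y

IsFibonacciPermutation : ∀ {k} → Permutation′ k → Set
IsFibonacciPermutation σ = ∀ i → ∣ toℕ (σ ⟨$⟩ʳ i) - toℕ i ∣ ℕ.≤ 1

-- The object counted is the resulting sequence of blocks, not the pair
-- (B , σ) it arises from.

IsFibonacciOrderedPartition : (n : ℕ) → List (Subset n) → Set
IsFibonacciOrderedPartition n π =
  Σ[ k ∈ ℕ ] Σ[ B ∈ (Fin k → Subset n) ] Σ[ σ ∈ Permutation′ k ]
    IsSetPartition B
    × IsFibonacciPermutation σ
    × π ≡ tabulate (λ i → B (σ ⟨$⟩ʳ i))

HasCardinality : {A : Set} → (A → Set) → ℕ → Set
HasCardinality {A} P m =
  ∃[ xs ] Unique xs × (∀ (x : A) → x List.∈ xs ⇔ P x) × length xs ≡ m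

HasCardinality-unique : {A : Set} {P : A → Set} {l m : ℕ} →
                        HasCardinality P l → HasCardinality P m → l ≡ m
HasCardinality-unique (_ , xs! , xs⇔P , ∣xs∣) (_ , ys! , ys⇔P , ∣ys∣) =
  trans (sym ∣xs∣) (trans (↭-length xs↭ys) ∣ys∣)
  where
  xs↭ys = ∼bag⇒↭ (unique∧set⇒bag xs! ys! (λ {x} → ⇔-sym (ys⇔P x) ⇔-∘ xs⇔P x))

IsFibonacciFubini : ℕ → ℕ → Set
IsFibonacciFubini n m = HasCardinality (IsFibonacciOrderedPartition n) m

-- a +√5 b stands for the real number a + b√5.  As 1 and √5 are linearly
-- independent over ℚ, equality of these reals is componentwise equality.

infix 5 _+√5_

record ℚ√5 : Set where
  constructor _+√5_
  field
    rat irr : ℚ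

infixl 6 _+_ _-_
infixl 7 _*_ _/_
infix  8 -_
infix  9 _⁻¹

_+_ _-_ _*_ : ℚ√5 → ℚ√5 → ℚ√5
(a +√5 b) + (c +√5 d) = (a ℚ.+ c) +√5 (b ℚ.+ d)
(a +√5 b) - (c +√5 d) = (a ℚ.- c) +√5 (b ℚ.- d)
(a +√5 b) * (c +√5 d) =
  (a ℚ.* c ℚ.+ (+ 5 ℚ./ 1) ℚ.* (b ℚ.* d)) +√5 (a ℚ.* d ℚ.+ b ℚ.* c)

-_ : ℚ√5 → ℚ√5
- (a +√5 b) = (ℚ.- a) +√5 (ℚ.- b)

fromℚ : ℚ → ℚ√5
fromℚ q = q +√5 0ℚ

fromℕ : ℕ → ℚ√5
fromℕ m = fromℚ (+ m ℚ./ 1)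

0# 1# √5 : ℚ√5
0# = fromℚ 0ℚ
1# = fromℚ 1ℚ
√5 = 0ℚ +√5 1ℚ

norm : ℚ√5 → ℚ
norm (a +√5 b) = a ℚ.* a ℚ.- (+ 5 ℚ./ 1) ℚ.* (b ℚ.* b)

-- 1 / (a + b√5) = (a - b√5) / (a² - 5b²)
_⁻¹ : (x : ℚ√5) .{{_ : ℚ.NonZero (norm x)}} → ℚ√5
(x@(a +√5 b)) ⁻¹ = (a ℚ.÷ norm x) +√5 ((ℚ.- b) ℚ.÷ norm x)

_/_ : ℚ√5 → (d : ℕ) .{{_ : ℕ.NonZero d}} → ℚ√5
x / d = x * fromℚ (+ 1 ℚ./ d)

√5*√5≡5 : √5 * √5 ≡ fromℕ 5
√5*√5≡5 = refl

√5*√5⁻¹≡1 : √5 * √5 ⁻¹ ≡ 1#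
√5*√5⁻¹≡1 = refl

α β : ℚ√5
α = (1# + √5) / 2
β = (1# - √5) / 2

ℚ√5-rawSemiring : RawSemiring 0ℓ 0ℓ
ℚ√5-rawSemiring = record
  { Carrier = ℚ√5
  ; _≈_     = _≡_
  ; _+_     = _+_
  ; _*_     = _*_
  ; 0#      = 0#
  ; 1#      = 1#
  }

-- Here x ^ 0 reduces to 1# for every x, including 0#.
open RawSemiringDefinitions ℚ√5-rawSemiring public using (_^_; sum)

∑≤ : ℕ → (ℕ → ℚ√5) → ℚ√5
∑≤ n f = sum {suc n} (f ∘ toℕ)

infixl 5 ∑≤
syntax ∑≤ n (λ k → e) = ∑[ k ≤ n ] e

{-# OPTIONS --safe #-}

-- A set partition of [n] is built by inserting the elements in increasing
-- order, each into one of the m blocks opened so far or into a new block.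
-- Hence, if every partition with k blocks is given the weight φ k, the total
-- weight of all partitions of [n] is the value at 0 of the n-th iterate on φ
-- of the operator (L φ) m = m φ(m) + φ(m + 1).  The Fibonacci-Fubini number
-- is the case where φ k = F (k + 1) counts the Fibonacci permutations of k
-- blocks.  Expanding the iterate in Stirling numbers gives Σₖ F (k + 1) S(n, k),
-- where k! S(n, k) is the k-th forward difference of jⁿ at j = 0, and Binet's
-- formula replaces F (k + 1).

module Submission where

open import Defs
open import Algebra.Bundles using (CommutativeRing)
import Algebra.Properties.Ring as RingProperties
import Algebra.Properties.Semiring.Sum as SemiringSum
import Algebra.Solver.Ring.AlmostCommutativeRing as AlmostCommutativeRing
import Algebra.Solver.Ring.Simple as RingSolver
open import Data.Empty using (⊥-elim)
open import Data.Fin.Base as Fin using (Fin; zero; suc; toℕ; fromℕ<)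
open import Data.Fin.Permutation as Perm
  using (Permutation′; _≈_; _⟨$⟩ʳ_; _⟨$⟩ˡ_; _∘ₚ_; lift₀; remove; transpose; lift₀-remove; inverseʳ)
import Data.Fin.Properties as Fin
open import Data.Fin.Subset using (Subset; _∈_; Nonempty; inside; outside)
open import Data.Integer.Base as ℤ using (+_)
import Data.Integer.Properties as ℤ
open import Data.List.Base as List
  using (List; []; _∷_; _++_; [_]; length; map; concatMap; replicate; tabulate; upTo)
import Data.List.Membership.Propositional as List
open import Data.List.Membership.Propositional using (find; lose)
import Data.List.Membership.Propositional.Properties as List
import Data.List.Properties as List
open import Data.List.Relation.Binary.Permutation.Propositional as ↭ using (_↭_; ↭-sym; ↭-trans)
open import Data.List.Relation.Binary.Permutation.Propositional.Properties
  using (drop-∷; ∈-resp-↭; ¬x∷xs↭[])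
open import Data.List.Relation.Unary.All as All using (All; []; _∷_)
open import Data.List.Relation.Unary.AllPairs as AllPairs using (AllPairs; []; _∷_)
import Data.List.Relation.Unary.AllPairs.Properties as AllPairs
open import Data.List.Relation.Unary.Any using (here; there)
open import Data.List.Relation.Unary.Unique.Propositional using (Unique)
import Data.List.Relation.Unary.Unique.Propositional.Properties as Unique
open import Data.Nat.Base as ℕ
  using (ℕ; zero; suc; _∸_; _!; _<_; z≤n; s≤s; s<s; _⊔_; _≡ᵇ_; ∣_-_∣)
open import Data.Nat.Combinatorics using (_C_; nCk+nC[k+1]≡[n+1]C[k+1]; k>n⇒nCk≡0)
import Data.Nat.ListAction as ℕ
open import Data.Nat.ListAction.Properties using (sum-++)
import Data.Nat.Properties as ℕ
open import Data.Nat.Properties using (_!≢0)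
import Data.Nat.Tactic.RingSolver as ℕ
open import Data.Product.Base using (∃-syntax; Σ-syntax; _×_; _,_; proj₁; proj₂)
open import Data.Rational.Base as ℚ using (0ℚ; 1ℚ)
import Data.Rational.Properties as ℚ
import Data.Rational.Solver as ℚ
open import Data.Rational.Unnormalised.Base as ℚᵘ using (mkℚᵘ)
import Data.Rational.Unnormalised.Properties as ℚᵘ
open import Data.Sum.Base using (_⊎_; inj₁; inj₂; [_,_]′)
open import Data.Vec.Base using ([]; _∷_; tail; here; there)
open import Function.Base using (_∘_)
open import Function.Bundles using (mk⇔)
open import Level using (0ℓ)
open import Relation.Binary.Core using (Rel)
open import Relation.Binary.Definitions using (Asymmetric; DecidableEquality)
open import Relation.Binary.PropositionalEquality
  using (_≡_; refl; sym; trans; cong; cong₂; subst; _≗_; module ≡-Reasoning)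
open import Relation.Nullary using (¬_; yes; no; contradiction)
open import Relation.Nullary.Decidable using (map′; _×-dec_; dec-true; dec-false)

private
  variable
    A B : Set
    k m n : ℕ

-- The ring ℚ(√5)

-- The identities hold with any number in place of 5, so 5 is passed to the solver as a variable.
*-assoc : ∀ x y z → (x * y) * z ≡ x * (y * z)
*-assoc (a +√5 b) (c +√5 d) (e +√5 f) = cong₂ _+√5_
  (solve 7 (λ a b c d e f s →
     (a :* c :+ s :* (b :* d)) :* e :+ s :* ((a :* d :+ b :* c) :* f) :=
     a :* (c :* e :+ s :* (d :* f)) :+ s :* (b :* (c :* f :+ d :* e))) refl a b c d e f s)
  (solve 7 (λ a b c d e f s →
     (a :* c :+ s :* (b :* d)) :* f :+ (a :* d :+ b :* c) :* e :=
     a :* (c :* f :+ d :* e) :+ b :* (c :* e :+ s :* (d :* f))) refl a b c d e f s)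
  where
  open ℚ.+-*-Solver
  s = + 5 ℚ./ 1

*-comm : ∀ x y → x * y ≡ y * x
*-comm (a +√5 b) (c +√5 d) = cong₂ _+√5_
  (cong₂ (λ u v → u ℚ.+ (+ 5 ℚ./ 1) ℚ.* v) (ℚ.*-comm a c) (ℚ.*-comm b d))
  (solve 4 (λ a b c d → a :* d :+ b :* c := c :* b :+ d :* a) refl a b c d)
  where open ℚ.+-*-Solver

*-identityˡ : ∀ x → 1# * x ≡ x
*-identityˡ (a +√5 b) = cong₂ _+√5_
  (solve 3 (λ a b s → con 1ℚ :* a :+ s :* (con 0ℚ :* b) := a) refl a b (+ 5 ℚ./ 1))
  (solve 2 (λ a b → con 1ℚ :* b :+ con 0ℚ :* a := b) refl a b)
  where open ℚ.+-*-Solver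

*-distribˡ-+ : ∀ x y z → x * (y + z) ≡ x * y + x * z
*-distribˡ-+ (a +√5 b) (c +√5 d) (e +√5 f) = cong₂ _+√5_
  (solve 7 (λ a b c d e f s →
     a :* (c :+ e) :+ s :* (b :* (d :+ f)) :=
     (a :* c :+ s :* (b :* d)) :+ (a :* e :+ s :* (b :* f))) refl a b c d e f (+ 5 ℚ./ 1))
  (solve 6 (λ a b c d e f →
     a :* (d :+ f) :+ b :* (c :+ e) := (a :* d :+ b :* c) :+ (a :* f :+ b :* e)) refl a b c d e f)
  where open ℚ.+-*-Solver

ℚ√5-commutativeRing : CommutativeRing 0ℓ 0ℓ
ℚ√5-commutativeRing = record
  { Carrier = ℚ√5 ; _≈_ = _≡_ ; _+_ = _+_ ; _*_ = _*_ ; -_ = λ x → - x ; 0# = 0# ; 1# = 1#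
  ; isCommutativeRing = record
    { isRing = record
      { +-isAbelianGroup = record
        { isGroup = record
          { isMonoid = record
            { isSemigroup = record
              { isMagma = isMagma _+_
              ; assoc = λ { (a +√5 b) (c +√5 d) (e +√5 f) →
                  cong₂ _+√5_ (ℚ.+-assoc a c e) (ℚ.+-assoc b d f) }
              }
            ; identity = comm∧idˡ⇒id +-comm λ { (a +√5 b) →
                cong₂ _+√5_ (ℚ.+-identityˡ a) (ℚ.+-identityˡ b) }
            }
          ; inverse = comm∧invˡ⇒inv +-comm λ { (a +√5 b) →
              cong₂ _+√5_ (ℚ.+-inverseˡ a) (ℚ.+-inverseˡ b) }
          ; ⁻¹-cong = cong (λ x → - x)
          }
        ; comm = +-comm
        }
      ; *-cong = cong₂ _*_
      ; *-assoc = *-assoc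
      ; *-identity = comm∧idˡ⇒id *-comm *-identityˡ
      ; distrib = *-distribˡ-+ , comm∧distrˡ⇒distrʳ *-comm *-distribˡ-+
      }
    ; *-comm = *-comm
    }
  }
  where
  open import Relation.Binary.PropositionalEquality.Algebra using (isMagma)
  open import Algebra.Consequences.Propositional
    using (comm∧idˡ⇒id; comm∧invˡ⇒inv; comm∧distrˡ⇒distrʳ)
  +-comm : ∀ x y → x + y ≡ y + x
  +-comm (a +√5 b) (c +√5 d) = cong₂ _+√5_ (ℚ.+-comm a c) (ℚ.+-comm b d)

-- Natural numbers and their reciprocals in ℚ(√5)

toℚᵘ-/ : ∀ m d → ℚ.toℚᵘ (+ m ℚ./ suc d) ℚᵘ.≃ mkℚᵘ (+ m) d
toℚᵘ-/ m d = ℚ.toℚᵘ-fromℚᵘ (mkℚᵘ (+ m) d)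

/1-homo-+ : ∀ m n → + (m ℕ.+ n) ℚ./ 1 ≡ (+ m ℚ./ 1) ℚ.+ (+ n ℚ./ 1)
-- `ℚ._/_` divides by a gcd that does not compute for variables; unnormalised fractions avoid it.
/1-homo-+ m n = ℚ.toℚᵘ-injective (begin
  ℚ.toℚᵘ (+ (m ℕ.+ n) ℚ./ 1)                     ≈⟨ toℚᵘ-/ (m ℕ.+ n) 0 ⟩
  mkℚᵘ (+ (m ℕ.+ n)) 0                           ≡⟨ cong (λ z → mkℚᵘ z 0) (cong₂ ℤ._+_ (ℤ.*-identityʳ (+ m)) (ℤ.*-identityʳ (+ n))) ⟨
  mkℚᵘ (+ m) 0 ℚᵘ.+ mkℚᵘ (+ n) 0                 ≈⟨ ℚᵘ.+-cong (toℚᵘ-/ m 0) (toℚᵘ-/ n 0) ⟨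
  ℚ.toℚᵘ (+ m ℚ./ 1) ℚᵘ.+ ℚ.toℚᵘ (+ n ℚ./ 1)     ≈⟨ ℚ.toℚᵘ-homo-+ (+ m ℚ./ 1) (+ n ℚ./ 1) ⟨
  ℚ.toℚᵘ ((+ m ℚ./ 1) ℚ.+ (+ n ℚ./ 1))           ∎)
  where open import Relation.Binary.Reasoning.Setoid ℚᵘ.≃-setoid

/1-homo-* : ∀ m n → + (m ℕ.* n) ℚ./ 1 ≡ (+ m ℚ./ 1) ℚ.* (+ n ℚ./ 1)
/1-homo-* m n = ℚ.toℚᵘ-injective (begin
  ℚ.toℚᵘ (+ (m ℕ.* n) ℚ./ 1)                     ≈⟨ toℚᵘ-/ (m ℕ.* n) 0 ⟩
  mkℚᵘ (+ (m ℕ.* n)) 0                           ≡⟨ cong (λ z → mkℚᵘ z 0) (ℤ.pos-* m n) ⟩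
  mkℚᵘ (+ m) 0 ℚᵘ.* mkℚᵘ (+ n) 0                 ≈⟨ ℚᵘ.*-cong (toℚᵘ-/ m 0) (toℚᵘ-/ n 0) ⟨
  ℚ.toℚᵘ (+ m ℚ./ 1) ℚᵘ.* ℚ.toℚᵘ (+ n ℚ./ 1)     ≈⟨ ℚ.toℚᵘ-homo-* (+ m ℚ./ 1) (+ n ℚ./ 1) ⟨
  ℚ.toℚᵘ ((+ m ℚ./ 1) ℚ.* (+ n ℚ./ 1))           ∎)
  where open import Relation.Binary.Reasoning.Setoid ℚᵘ.≃-setoid

/1-inverse : ∀ d .{{_ : ℕ.NonZero d}} → (+ d ℚ./ 1) ℚ.* (+ 1 ℚ./ d) ≡ 1ℚ
/1-inverse (suc d) = ℚ.toℚᵘ-injective (begin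
  ℚ.toℚᵘ ((+ suc d ℚ./ 1) ℚ.* (+ 1 ℚ./ suc d))          ≈⟨ ℚ.toℚᵘ-homo-* (+ suc d ℚ./ 1) (+ 1 ℚ./ suc d) ⟩
  ℚ.toℚᵘ (+ suc d ℚ./ 1) ℚᵘ.* ℚ.toℚᵘ (+ 1 ℚ./ suc d)    ≈⟨ ℚᵘ.*-cong (toℚᵘ-/ (suc d) 0) (toℚᵘ-/ 1 d) ⟩
  mkℚᵘ (+ suc d) 0 ℚᵘ.* mkℚᵘ (+ 1) d                    ≈⟨ ℚᵘ.*-inverseʳ (mkℚᵘ (+ suc d) 0) ⟩
  ℚᵘ.1ℚᵘ                                                ∎)
  where open import Relation.Binary.Reasoning.Setoid ℚᵘ.≃-setoid

fromℚ-homo-* : ∀ p q → fromℚ (p ℚ.* q) ≡ fromℚ p * fromℚ q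
fromℚ-homo-* p q = cong₂ _+√5_
  (solve 3 (λ p q s → p :* q := p :* q :+ s :* (con 0ℚ :* con 0ℚ)) refl p q (+ 5 ℚ./ 1))
  (solve 2 (λ p q → con 0ℚ := p :* con 0ℚ :+ con 0ℚ :* q) refl p q)
  where open ℚ.+-*-Solver

fromℕ-homo-+ : ∀ m n → fromℕ (m ℕ.+ n) ≡ fromℕ m + fromℕ n
fromℕ-homo-+ m n = cong fromℚ (/1-homo-+ m n)

fromℕ-homo-* : ∀ m n → fromℕ (m ℕ.* n) ≡ fromℕ m * fromℕ n
fromℕ-homo-* m n = trans (cong fromℚ (/1-homo-* m n)) (fromℚ-homo-* (+ m ℚ./ 1) (+ n ℚ./ 1))

fromℕ-inverse : ∀ d .{{_ : ℕ.NonZero d}} → fromℕ d * fromℚ (+ 1 ℚ./ d) ≡ 1#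
fromℕ-inverse d = trans (sym (fromℚ-homo-* (+ d ℚ./ 1) (+ 1 ℚ./ d))) (cong fromℚ (/1-inverse d))

open ≡-Reasoning

open CommutativeRing ℚ√5-commutativeRing
  using (zeroˡ; zeroʳ; +-identityˡ; +-identityʳ; distribʳ; semiring; ring)
open SemiringSum semiring using (sum-cong-≗; sum-init-last; ∑-distrib-+; *-distribˡ-sum)

infix 4 _≟_
-- Lets the ring solver compare coefficients, which are themselves elements of ℚ(√5).
_≟_ : DecidableEquality ℚ√5
(a +√5 b) ≟ (c +√5 d) =
  map′ (λ { (p , q) → cong₂ _+√5_ p q }) (λ { refl → refl , refl }) (a ℚ.≟ c ×-dec b ℚ.≟ d)

module ℚ√5-Solver = RingSolver (AlmostCommutativeRing.fromCommutativeRing ℚ√5-commutativeRing) _≟_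

-- Finite differences and Stirling numbers

-- Agreement is required at every `k`, also beyond `n`; the identities between summands below
-- therefore cover indices where the binomial coefficient vanishes.
∑-cong : ∀ n {f g : ℕ → ℚ√5} → (∀ k → f k ≡ g k) → ∑≤ n f ≡ ∑≤ n g
∑-cong n f≗g = sum-cong-≗ {suc n} (f≗g ∘ toℕ)

∑-last : ∀ n f → ∑≤ (suc n) f ≡ ∑≤ n f + f (suc n)
∑-last n f = trans (sum-init-last {suc n} (f ∘ toℕ))
  (cong₂ _+_ (sum-cong-≗ {suc n} (cong f ∘ Fin.toℕ-inject₁)) (cong (f ∘ suc) (Fin.toℕ-fromℕ n)))

∑-+ : ∀ n f g → ∑[ k ≤ n ] (f k + g k) ≡ ∑≤ n f + ∑≤ n g
∑-+ n f g = ∑-distrib-+ {suc n} (f ∘ toℕ) (g ∘ toℕ)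

*-∑ : ∀ n x f → x * ∑≤ n f ≡ ∑[ k ≤ n ] (x * f k)
*-∑ n x f = *-distribˡ-sum {suc n} x (f ∘ toℕ)

-- The absorption identity, by induction with Pascal's rule; stated without division, it also holds
-- for j > n, where both sides vanish.
[1+j]*[1+n]C[1+j]≡[1+n]*nCj : ∀ n j → suc j ℕ.* (suc n C suc j) ≡ suc n ℕ.* (n C j)
[1+j]*[1+n]C[1+j]≡[1+n]*nCj zero zero    = refl
[1+j]*[1+n]C[1+j]≡[1+n]*nCj zero (suc j) = begin
  suc (suc j) ℕ.* (1 C suc (suc j)) ≡⟨ cong (suc (suc j) ℕ.*_) (k>n⇒nCk≡0 {1} {suc (suc j)} (s<s (s≤s z≤n))) ⟩
  suc (suc j) ℕ.* 0                 ≡⟨ ℕ.*-zeroʳ (suc (suc j)) ⟩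
  0                                 ≡⟨ cong (1 ℕ.*_) (k>n⇒nCk≡0 {0} {suc j} (s<s z≤n)) ⟨
  1 ℕ.* (0 C suc j)                 ∎
[1+j]*[1+n]C[1+j]≡[1+n]*nCj (suc n) zero = begin
  1 ℕ.* (suc (suc n) C 1)                ≡⟨ cong (1 ℕ.*_) (nCk+nC[k+1]≡[n+1]C[k+1] (suc n) 0) ⟨
  1 ℕ.* ((suc n C 0) ℕ.+ (suc n C 1))    ≡⟨ ℕ.*-distribˡ-+ 1 (suc n C 0) (suc n C 1) ⟩
  1 ℕ.+ 1 ℕ.* (suc n C 1)                ≡⟨ cong (1 ℕ.+_) ([1+j]*[1+n]C[1+j]≡[1+n]*nCj n 0) ⟩
  1 ℕ.+ suc n ℕ.* 1                      ∎
[1+j]*[1+n]C[1+j]≡[1+n]*nCj (suc n) (suc j) = begin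
  suc (suc j) ℕ.* (suc (suc n) C suc (suc j))
    ≡⟨ cong (suc (suc j) ℕ.*_) (nCk+nC[k+1]≡[n+1]C[k+1] (suc n) (suc j)) ⟨
  suc (suc j) ℕ.* (c ℕ.+ (suc n C suc (suc j)))
    ≡⟨ ℕ.*-distribˡ-+ (suc (suc j)) c (suc n C suc (suc j)) ⟩
  -- One copy of `c` is set aside so that the induction hypothesis applies to both remaining
  -- products.
  (c ℕ.+ suc j ℕ.* c) ℕ.+ suc (suc j) ℕ.* (suc n C suc (suc j))
    ≡⟨ cong₂ (λ u v → (c ℕ.+ u) ℕ.+ v) ([1+j]*[1+n]C[1+j]≡[1+n]*nCj n j) ([1+j]*[1+n]C[1+j]≡[1+n]*nCj n (suc j)) ⟩
  (c ℕ.+ suc n ℕ.* (n C j)) ℕ.+ suc n ℕ.* (n C suc j)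
    ≡⟨ ℕ.+-assoc c _ _ ⟩
  c ℕ.+ (suc n ℕ.* (n C j) ℕ.+ suc n ℕ.* (n C suc j))
    ≡⟨ cong (c ℕ.+_) (ℕ.*-distribˡ-+ (suc n) (n C j) (n C suc j)) ⟨
  c ℕ.+ suc n ℕ.* ((n C j) ℕ.+ (n C suc j))
    ≡⟨ cong (λ z → c ℕ.+ suc n ℕ.* z) (nCk+nC[k+1]≡[n+1]C[k+1] n j) ⟩
  suc (suc n) ℕ.* c ∎
  where c = suc n C suc j

-- Δ^ k f is the k-th forward difference of f at 0.
Δ^ : ℕ → (ℕ → ℚ√5) → ℚ√5
Δ^ k f = ∑[ j ≤ k ] ((- 1#) ^ (k ∸ j) * fromℕ (k C j) * f j)

-- Pascal's rule splits every term with positive index. One half sums to the difference of the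
-- shifted function; the other half, completed by the term at 0, is minus the difference of `f` with
-- an extra top term, which is zero.
Δ^-suc : ∀ k f → Δ^ (suc k) f ≡ Δ^ k (f ∘ suc) + (- 1#) * Δ^ k f
Δ^-suc k f = begin
  t₀ + (∑[ j ≤ k ] ((- 1#) ^ (k ∸ j) * fromℕ (suc k C suc j) * f (suc j)))
    ≡⟨ cong (_+_ t₀) (∑-cong k split) ⟩
  t₀ + (∑[ j ≤ k ] (a j + (- 1#) * b (suc j)))
    ≡⟨ cong (_+_ t₀) (∑-+ k a (λ j → (- 1#) * b (suc j))) ⟩
  t₀ + (∑≤ k a + (∑[ j ≤ k ] ((- 1#) * b (suc j))))
    ≡⟨ cong (λ z → t₀ + (∑≤ k a + z)) (*-∑ k (- 1#) (b ∘ suc)) ⟨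
  t₀ + (∑≤ k a + (- 1#) * ∑≤ k (b ∘ suc))
    ≡⟨ cong (λ z → z + (∑≤ k a + (- 1#) * ∑≤ k (b ∘ suc))) t₀≡ ⟩
  (- 1#) * b 0 + (∑≤ k a + (- 1#) * ∑≤ k (b ∘ suc))
    ≡⟨ solve 4 (λ m b₀ x y → m :* b₀ :+ (x :+ m :* y) := x :+ m :* (b₀ :+ y)) refl
         (- 1#) (b 0) (∑≤ k a) (∑≤ k (b ∘ suc)) ⟩
  ∑≤ k a + (- 1#) * ∑≤ (suc k) b
    ≡⟨ cong (λ z → ∑≤ k a + (- 1#) * z) (trans (∑-last k b) (trans (cong (_+_ (∑≤ k b)) b-last) (+-identityʳ (∑≤ k b)))) ⟩
  ∑≤ k a + (- 1#) * ∑≤ k b ∎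
  where
  open ℚ√5-Solver using (solve; _:*_; _:+_; _:=_)
  t₀ = (- 1#) ^ suc k * fromℕ 1 * f 0
  a b : ℕ → ℚ√5
  a j = (- 1#) ^ (k ∸ j) * fromℕ (k C j) * f (suc j)
  b j = (- 1#) ^ (k ∸ j) * fromℕ (k C j) * f j
  b-last : b (suc k) ≡ 0#
  b-last = trans (cong (λ c → (- 1#) ^ (k ∸ suc k) * fromℕ c * f (suc k)) (k>n⇒nCk≡0 {k} {suc k} (ℕ.n<1+n k)))
    (trans (cong (λ z → z * f (suc k)) (zeroʳ ((- 1#) ^ (k ∸ suc k)))) (zeroˡ (f (suc k))))
  t₀≡ : t₀ ≡ (- 1#) * b 0
  t₀≡ = solve 4 (λ m p c x → m :* p :* c :* x := m :* (p :* c :* x)) refl (- 1#) ((- 1#) ^ k) (fromℕ 1) (f 0)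
  sign : ∀ j → (- 1#) ^ (k ∸ j) * fromℕ (k C suc j) ≡ (- 1#) * ((- 1#) ^ (k ∸ suc j) * fromℕ (k C suc j))
  sign j with ℕ.<-≤-connex j k
  ... | inj₁ j<k = trans (cong (λ e → (- 1#) ^ e * fromℕ (k C suc j)) (ℕ.+-∸-assoc 1 j<k))
                         (*-assoc (- 1#) ((- 1#) ^ (k ∸ suc j)) (fromℕ (k C suc j)))
  -- Both truncated exponents are 0 here, so the signs disagree, but the binomial coefficient is
  -- zero.
  ... | inj₂ k≤j rewrite k>n⇒nCk≡0 {k} {suc j} (s≤s k≤j) =
    trans (zeroʳ ((- 1#) ^ (k ∸ j))) (sym (trans (cong (_*_ (- 1#)) (zeroʳ ((- 1#) ^ (k ∸ suc j)))) (zeroʳ (- 1#))))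
  split : ∀ j → (- 1#) ^ (k ∸ j) * fromℕ (suc k C suc j) * f (suc j) ≡ a j + (- 1#) * b (suc j)
  split j = begin
    s * fromℕ (suc k C suc j) * f (suc j)
      ≡⟨ cong (λ c → s * fromℕ c * f (suc j)) (nCk+nC[k+1]≡[n+1]C[k+1] k j) ⟨
    s * fromℕ ((k C j) ℕ.+ (k C suc j)) * f (suc j)
      ≡⟨ cong (λ c → s * c * f (suc j)) (fromℕ-homo-+ (k C j) (k C suc j)) ⟩
    s * (fromℕ (k C j) + fromℕ (k C suc j)) * f (suc j)
      ≡⟨ solve 4 (λ s c d x → s :* (c :+ d) :* x := s :* c :* x :+ s :* d :* x) refl s (fromℕ (k C j)) (fromℕ (k C suc j)) (f (suc j)) ⟩
    a j + s * fromℕ (k C suc j) * f (suc j)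
      ≡⟨ cong (λ z → a j + z * f (suc j)) (sign j) ⟩
    a j + (- 1#) * ((- 1#) ^ (k ∸ suc j) * fromℕ (k C suc j)) * f (suc j)
      ≡⟨ cong (_+_ (a j)) (*-assoc (- 1#) ((- 1#) ^ (k ∸ suc j) * fromℕ (k C suc j)) (f (suc j))) ⟩
    a j + (- 1#) * b (suc j) ∎
    where s = (- 1#) ^ (k ∸ j)

-- The factor j kills the term at 0; in the others absorption replaces j C(k + 1, j) by (k + 1) C(k,
-- j - 1).
Δ^-suc-id* : ∀ k f → Δ^ (suc k) (λ j → fromℕ j * f j) ≡ fromℕ (suc k) * Δ^ k (f ∘ suc)
Δ^-suc-id* k f = begin
  t₀ + (∑[ j ≤ k ] (s j * fromℕ (suc k C suc j) * (fromℕ (suc j) * f (suc j))))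
    ≡⟨ cong₂ _+_ (trans (cong (_*_ ((- 1#) ^ suc k * fromℕ 1)) (zeroˡ (f 0))) (zeroʳ ((- 1#) ^ suc k * fromℕ 1))) (∑-cong k absorb) ⟩
  0# + (∑[ j ≤ k ] (fromℕ (suc k) * (s j * fromℕ (k C j) * f (suc j))))
    ≡⟨ +-identityˡ _ ⟩
  ∑[ j ≤ k ] (fromℕ (suc k) * (s j * fromℕ (k C j) * f (suc j)))
    ≡⟨ *-∑ k (fromℕ (suc k)) (λ j → s j * fromℕ (k C j) * f (suc j)) ⟨
  fromℕ (suc k) * Δ^ k (f ∘ suc) ∎
  where
  open ℚ√5-Solver using (solve; _:*_; _:+_; _:=_)
  t₀ = (- 1#) ^ suc k * fromℕ 1 * (fromℕ 0 * f 0)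
  s : ℕ → ℚ√5
  s j = (- 1#) ^ (k ∸ j)
  absorb : ∀ j → s j * fromℕ (suc k C suc j) * (fromℕ (suc j) * f (suc j)) ≡
                 fromℕ (suc k) * (s j * fromℕ (k C j) * f (suc j))
  absorb j = begin
    s j * fromℕ (suc k C suc j) * (fromℕ (suc j) * f (suc j))
      ≡⟨ solve 4 (λ s c d x → s :* c :* (d :* x) := s :* (d :* c) :* x) refl (s j) (fromℕ (suc k C suc j)) (fromℕ (suc j)) (f (suc j)) ⟩
    s j * (fromℕ (suc j) * fromℕ (suc k C suc j)) * f (suc j)
      ≡⟨ cong (λ z → s j * z * f (suc j)) (trans (sym (fromℕ-homo-* (suc j) (suc k C suc j)))
           (trans (cong fromℕ ([1+j]*[1+n]C[1+j]≡[1+n]*nCj k j)) (fromℕ-homo-* (suc k) (k C j)))) ⟩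
    s j * (fromℕ (suc k) * fromℕ (k C j)) * f (suc j)
      ≡⟨ solve 4 (λ s c d x → s :* (d :* c) :* x := d :* (s :* c :* x)) refl (s j) (fromℕ (k C j)) (fromℕ (suc k)) (f (suc j)) ⟩
    fromℕ (suc k) * (s j * fromℕ (k C j) * f (suc j)) ∎

-- S n k is a Stirling number of the second kind.
S : ℕ → ℕ → ℕ
S zero    zero    = 1
S zero    (suc k) = 0
S (suc n) zero    = 0
S (suc n) (suc k) = suc k ℕ.* S n (suc k) ℕ.+ S n k

S-> : ∀ {n k} → n < k → S n k ≡ 0
S-> {zero}  {suc k} _ = refl
S-> {suc n} {suc k} (s<s n<k) = cong₂ ℕ._+_
  (trans (cong (suc k ℕ.*_) (S-> (ℕ.m<n⇒m<1+n n<k))) (ℕ.*-zeroʳ (suc k))) (S-> n<k)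

x+-1*x≡0 : ∀ x → x + (- 1#) * x ≡ 0#
x+-1*x≡0 x = trans (cong (_+_ x) (RingProperties.-1*x≈-x ring x))
  (CommutativeRing.-‿inverseʳ ℚ√5-commutativeRing x)

-- Induction on `n`: one factor j is absorbed, and what results is the Stirling recurrence
-- multiplied by k!.
Δ^-^ : ∀ n k → Δ^ k (λ j → fromℕ j ^ n) ≡ fromℕ (k ! ℕ.* S n k)
Δ^-^ zero zero = refl
-- The zeroth power is the constant 1, at j = 0 too, so it equals its own shift and its differences
-- cancel.
Δ^-^ zero (suc k) = begin
  Δ^ (suc k) (λ _ → 1#)                        ≡⟨ Δ^-suc k (λ _ → 1#) ⟩
  Δ^ k (λ _ → 1#) + (- 1#) * Δ^ k (λ _ → 1#)   ≡⟨ x+-1*x≡0 (Δ^ k (λ _ → 1#)) ⟩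
  0#                                           ≡⟨ cong fromℕ (ℕ.*-zeroʳ (suc k !)) ⟨
  fromℕ (suc k ! ℕ.* 0)                        ∎
Δ^-^ (suc n) zero = begin
  1# * fromℕ 1 * (fromℕ 0 * fromℕ 0 ^ n) + 0#  ≡⟨ +-identityʳ _ ⟩
  1# * fromℕ 1 * (fromℕ 0 * fromℕ 0 ^ n)       ≡⟨ cong (_*_ (1# * fromℕ 1)) (zeroˡ (fromℕ 0 ^ n)) ⟩
  1# * fromℕ 1 * 0#                            ≡⟨ zeroʳ (1# * fromℕ 1) ⟩
  0#                                           ∎
Δ^-^ (suc n) (suc k) = begin
  Δ^ (suc k) (λ j → fromℕ j * fromℕ j ^ n)
    ≡⟨ Δ^-suc-id* k p ⟩
  fromℕ (suc k) * Δ^ k (p ∘ suc)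
    -- Prepares `Δ^-suc` for use from right to left: the difference of the shift is the sum of two
    -- consecutive differences of `p`.
    ≡⟨ cong (_*_ (fromℕ (suc k))) (solve 2 (λ x y → x := x :+ con (- 1#) :* y :+ y) refl (Δ^ k (p ∘ suc)) (Δ^ k p)) ⟩
  fromℕ (suc k) * (Δ^ k (p ∘ suc) + (- 1#) * Δ^ k p + Δ^ k p)
    ≡⟨ cong (λ z → fromℕ (suc k) * (z + Δ^ k p)) (Δ^-suc k p) ⟨
  fromℕ (suc k) * (Δ^ (suc k) p + Δ^ k p)
    ≡⟨ cong₂ (λ x y → fromℕ (suc k) * (x + y)) (Δ^-^ n (suc k)) (Δ^-^ n k) ⟩
  fromℕ (suc k) * (fromℕ (suc k ! ℕ.* S n (suc k)) + fromℕ (k ! ℕ.* S n k))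
    ≡⟨ cong (_*_ (fromℕ (suc k))) (fromℕ-homo-+ (suc k ! ℕ.* S n (suc k)) (k ! ℕ.* S n k)) ⟨
  fromℕ (suc k) * fromℕ (suc k ! ℕ.* S n (suc k) ℕ.+ k ! ℕ.* S n k)
    ≡⟨ fromℕ-homo-* (suc k) (suc k ! ℕ.* S n (suc k) ℕ.+ k ! ℕ.* S n k) ⟨
  fromℕ (suc k ℕ.* (suc k ! ℕ.* S n (suc k) ℕ.+ k ! ℕ.* S n k))
    ≡⟨ cong fromℕ (ring-id (suc k) (k !) (S n (suc k)) (S n k)) ⟩
  fromℕ (suc k ! ℕ.* S (suc n) (suc k)) ∎
  where
  open ℚ√5-Solver using (solve; con; _:*_; _:+_; _:=_)
  p : ℕ → ℚ√5
  p j = fromℕ j ^ n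
  ring-id : ∀ c d s t → c ℕ.* ((c ℕ.* d) ℕ.* s ℕ.+ d ℕ.* t) ≡ (c ℕ.* d) ℕ.* (c ℕ.* s ℕ.+ t)
  ring-id = ℕ.solve-∀

-- Shifted index: fib k is the Fibonacci number F (k + 1).
fib : ℕ → ℕ
fib zero          = 1
fib (suc zero)    = 1
fib (suc (suc k)) = fib (suc k) ℕ.+ fib k

-- As roots of x² = x + 1, both α and β have powers that obey the Fibonacci recurrence.
binet : ∀ k → α ^ suc k - β ^ suc k ≡ √5 * fromℕ (fib k)
binet zero          = refl
binet (suc zero)    = refl
binet (suc (suc k)) = begin
  α ^ (3 ℕ.+ k) - β ^ (3 ℕ.+ k)
    -- The quadratic equations of α and β are closed, so `refl` checks them by rational arithmetic.
    ≡⟨ cong₂ _-_ (golden α refl (suc k)) (golden β refl (suc k)) ⟩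
  (α ^ (2 ℕ.+ k) + α ^ suc k) - (β ^ (2 ℕ.+ k) + β ^ suc k)
    ≡⟨ interchange (α ^ (2 ℕ.+ k)) (α ^ suc k) (β ^ (2 ℕ.+ k)) (β ^ suc k) ⟩
  (α ^ (2 ℕ.+ k) - β ^ (2 ℕ.+ k)) + (α ^ suc k - β ^ suc k)
    ≡⟨ cong₂ _+_ (binet (suc k)) (binet k) ⟩
  √5 * fromℕ (fib (suc k)) + √5 * fromℕ (fib k)
    ≡⟨ *-distribˡ-+ √5 (fromℕ (fib (suc k))) (fromℕ (fib k)) ⟨
  √5 * (fromℕ (fib (suc k)) + fromℕ (fib k))
    ≡⟨ cong (_*_ √5) (fromℕ-homo-+ (fib (suc k)) (fib k)) ⟨
  √5 * fromℕ (fib (suc (suc k))) ∎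
  where
  golden : ∀ x → x * x ≡ x + 1# → ∀ n → x ^ (2 ℕ.+ n) ≡ x ^ suc n + x ^ n
  golden x x²≡x+1 n = begin
    x * (x * x ^ n)        ≡⟨ *-assoc x x (x ^ n) ⟨
    x * x * x ^ n          ≡⟨ cong (λ z → z * x ^ n) x²≡x+1 ⟩
    (x + 1#) * x ^ n       ≡⟨ distribʳ (x ^ n) x 1# ⟩
    x * x ^ n + 1# * x ^ n ≡⟨ cong (_+_ (x ^ suc n)) (*-identityˡ (x ^ n)) ⟩
    x ^ suc n + x ^ n      ∎
  interchange : ∀ a b c d → (a + b) - (c + d) ≡ (a - c) + (b - d)
  interchange = solve 4 (λ a b c d → (a :+ b) :- (c :+ d) := (a :- c) :+ (b :- d)) refl
    where open ℚ√5-Solver using (solve; _:-_; _:+_; _:=_)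

-- Weighted Stirling sums as iterates of an operator

∑ᴺ : ℕ → (ℕ → ℕ) → ℕ
∑ᴺ zero    f = f 0
∑ᴺ (suc n) f = f 0 ℕ.+ ∑ᴺ n (f ∘ suc)

∑ᴺ-last : ∀ n f → ∑ᴺ (suc n) f ≡ ∑ᴺ n f ℕ.+ f (suc n)
∑ᴺ-last zero    f = refl
∑ᴺ-last (suc n) f = trans (cong (f 0 ℕ.+_) (∑ᴺ-last n (f ∘ suc))) (sym (ℕ.+-assoc (f 0) _ _))

∑ᴺ-cong : ∀ n {f g} → (∀ k → f k ≡ g k) → ∑ᴺ n f ≡ ∑ᴺ n g
∑ᴺ-cong zero    f≗g = f≗g 0
∑ᴺ-cong (suc n) f≗g = cong₂ ℕ._+_ (f≗g 0) (∑ᴺ-cong n (f≗g ∘ suc))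

∑ᴺ-+ : ∀ n f g → ∑ᴺ n (λ k → f k ℕ.+ g k) ≡ ∑ᴺ n f ℕ.+ ∑ᴺ n g
∑ᴺ-+ zero    f g = refl
∑ᴺ-+ (suc n) f g = trans (cong (f 0 ℕ.+ g 0 ℕ.+_) (∑ᴺ-+ n (f ∘ suc) (g ∘ suc)))
  (interchange (f 0) (g 0) (∑ᴺ n (f ∘ suc)) (∑ᴺ n (g ∘ suc)))
  where
  interchange : ∀ a b c d → a ℕ.+ b ℕ.+ (c ℕ.+ d) ≡ a ℕ.+ c ℕ.+ (b ℕ.+ d)
  interchange = ℕ.solve-∀

L : (ℕ → ℕ) → ℕ → ℕ
L φ m = m ℕ.* φ m ℕ.+ φ (suc m)

L^ : ℕ → (ℕ → ℕ) → ℕ → ℕ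
L^ zero    φ = φ
L^ (suc n) φ = L (L^ n φ)

-- `L^` adds a new `L` on the outside, while the Stirling recurrence puts it next to `φ`.
L^-L : ∀ n φ → L^ n (L φ) ≡ L (L^ n φ)
L^-L zero    φ = refl
L^-L (suc n) φ = cong L (L^-L n φ)

-- The Stirling recurrence moves onto the weight: summing `φ` against row n + 1 is summing `L φ`
-- against row n. The induction thus needs arbitrary `φ`.
∑S≡L^ : ∀ n φ → ∑ᴺ n (λ k → φ k ℕ.* S n k) ≡ L^ n φ 0
∑S≡L^ zero    φ = ℕ.*-identityʳ (φ 0)
∑S≡L^ (suc n) φ = begin
  φ 0 ℕ.* 0 ℕ.+ ∑ᴺ n (λ k → φ (suc k) ℕ.* (suc k ℕ.* S n (suc k) ℕ.+ S n k))
    ≡⟨ cong₂ ℕ._+_ (ℕ.*-zeroʳ (φ 0)) (∑ᴺ-cong n λ k → expand (φ (suc k)) (suc k) (S n (suc k)) (S n k)) ⟩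
  ∑ᴺ n (λ k → g (suc k) ℕ.+ φ (suc k) ℕ.* S n k)
    ≡⟨ ∑ᴺ-+ n (g ∘ suc) (λ k → φ (suc k) ℕ.* S n k) ⟩
  -- `g 0` reduces to 0, so the shifted sum already is the sum up to n + 1. Its last term contains
  -- S(n, n + 1) = 0.
  ∑ᴺ (suc n) g ℕ.+ ∑ᴺ n (λ k → φ (suc k) ℕ.* S n k)
    ≡⟨ cong (ℕ._+ ∑ᴺ n (λ k → φ (suc k) ℕ.* S n k)) (∑ᴺ-last n g) ⟩
  ∑ᴺ n g ℕ.+ g (suc n) ℕ.+ ∑ᴺ n (λ k → φ (suc k) ℕ.* S n k)
    ≡⟨ cong (λ z → ∑ᴺ n g ℕ.+ z ℕ.+ ∑ᴺ n (λ k → φ (suc k) ℕ.* S n k)) g-last ⟩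
  ∑ᴺ n g ℕ.+ 0 ℕ.+ ∑ᴺ n (λ k → φ (suc k) ℕ.* S n k)
    ≡⟨ cong (ℕ._+ ∑ᴺ n (λ k → φ (suc k) ℕ.* S n k)) (ℕ.+-identityʳ (∑ᴺ n g)) ⟩
  ∑ᴺ n g ℕ.+ ∑ᴺ n (λ k → φ (suc k) ℕ.* S n k)
    ≡⟨ ∑ᴺ-+ n g (λ k → φ (suc k) ℕ.* S n k) ⟨
  ∑ᴺ n (λ k → g k ℕ.+ φ (suc k) ℕ.* S n k)
    ≡⟨ ∑ᴺ-cong n (λ k → ℕ.*-distribʳ-+ (S n k) (k ℕ.* φ k) (φ (suc k))) ⟨
  ∑ᴺ n (λ k → L φ k ℕ.* S n k)
    ≡⟨ ∑S≡L^ n (L φ) ⟩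
  L^ n (L φ) 0
    ≡⟨ cong (λ ψ → ψ 0) (L^-L n φ) ⟩
  L^ (suc n) φ 0 ∎
  where
  g : ℕ → ℕ
  g k = k ℕ.* φ k ℕ.* S n k
  g-last : g (suc n) ≡ 0
  g-last = trans (cong (suc n ℕ.* φ (suc n) ℕ.*_) (S-> (ℕ.n<1+n n))) (ℕ.*-zeroʳ (suc n ℕ.* φ (suc n)))
  expand : ∀ x c s t → x ℕ.* (c ℕ.* s ℕ.+ t) ≡ c ℕ.* x ℕ.* s ℕ.+ x ℕ.* t
  expand = ℕ.solve-∀

fromℕ-∑ : ∀ n f → fromℕ (∑ᴺ n f) ≡ ∑[ k ≤ n ] (fromℕ (f k))
fromℕ-∑ zero    f = sym (+-identityʳ _)
fromℕ-∑ (suc n) f = trans (fromℕ-homo-+ (f 0) _) (cong (_+_ (fromℕ (f 0))) (fromℕ-∑ n (f ∘ suc)))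

-- The inner sum is a k-th difference of jⁿ times a Binet quotient; its value k! S(n, k) cancels the
-- k! of the denominator, and the √5 from Binet's formula cancels the prefactor.
explicit-formula : ∀ n → √5 ⁻¹ * (∑[ k ≤ n ] ∑[ j ≤ k ]
      ((- 1#) ^ (k ∸ j) * fromℕ (k C j) * ((α ^ suc k - β ^ suc k) / (k !)) {{k ℕ.!≢0}} * fromℕ j ^ n))
   ≡ fromℕ (∑ᴺ n (λ k → fib k ℕ.* S n k))
explicit-formula n = begin
  √5 ⁻¹ * (∑[ k ≤ n ] ∑[ j ≤ k ] (s k j * c k j * q k * p j))
    ≡⟨ cong (_*_ (√5 ⁻¹)) (∑-cong n inner) ⟩
  √5 ⁻¹ * (∑[ k ≤ n ] (√5 * fromℕ (fib k ℕ.* S n k)))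
    ≡⟨ cong (_*_ (√5 ⁻¹)) (*-∑ n √5 (λ k → fromℕ (fib k ℕ.* S n k))) ⟨
  √5 ⁻¹ * (√5 * (∑[ k ≤ n ] (fromℕ (fib k ℕ.* S n k))))
    ≡⟨ *-assoc (√5 ⁻¹) √5 (∑[ k ≤ n ] (fromℕ (fib k ℕ.* S n k))) ⟨
  -- The closed product `√5 ⁻¹ * √5` computes to `1#`.
  1# * (∑[ k ≤ n ] (fromℕ (fib k ℕ.* S n k)))
    ≡⟨ *-identityˡ _ ⟩
  ∑[ k ≤ n ] (fromℕ (fib k ℕ.* S n k))
    ≡⟨ fromℕ-∑ n (λ k → fib k ℕ.* S n k) ⟨
  fromℕ (∑ᴺ n (λ k → fib k ℕ.* S n k)) ∎
  where
  open ℚ√5-Solver using (solve; _:*_; _:=_)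
  s c : ℕ → ℕ → ℚ√5
  s k j = (- 1#) ^ (k ∸ j)
  c k j = fromℕ (k C j)
  q r p : ℕ → ℚ√5
  q k = ((α ^ suc k - β ^ suc k) / (k !)) {{k ℕ.!≢0}}
  r k = fromℚ ((+ 1 ℚ./ (k !)) {{k ℕ.!≢0}})
  p j = fromℕ j ^ n
  inner : ∀ k → ∑[ j ≤ k ] (s k j * c k j * q k * p j) ≡ √5 * fromℕ (fib k ℕ.* S n k)
  inner k = begin
    ∑[ j ≤ k ] (s k j * c k j * q k * p j)
      ≡⟨ ∑-cong k (λ j → solve 4 (λ s c q p → s :* c :* q :* p := q :* (s :* c :* p)) refl (s k j) (c k j) (q k) (p j)) ⟩
    ∑[ j ≤ k ] (q k * (s k j * c k j * p j))
      ≡⟨ *-∑ k (q k) (λ j → s k j * c k j * p j) ⟨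
    q k * Δ^ k p
      ≡⟨ cong₂ _*_ (cong (λ z → z * r k) (binet k)) (trans (Δ^-^ n k) (fromℕ-homo-* (k !) (S n k))) ⟩
    √5 * fromℕ (fib k) * r k * (fromℕ (k !) * fromℕ (S n k))
      ≡⟨ solve 5 (λ w f r d t → w :* f :* r :* (d :* t) := w :* ((d :* r) :* (f :* t))) refl
           √5 (fromℕ (fib k)) (r k) (fromℕ (k !)) (fromℕ (S n k)) ⟩
    √5 * ((fromℕ (k !) * r k) * (fromℕ (fib k) * fromℕ (S n k)))
      ≡⟨ cong (_*_ √5) (cong₂ _*_ (fromℕ-inverse (k !) {{k ℕ.!≢0}}) (sym (fromℕ-homo-* (fib k) (S n k)))) ⟩
    √5 * (1# * fromℕ (fib k ℕ.* S n k))
      ≡⟨ cong (_*_ √5) (*-identityˡ (fromℕ (fib k ℕ.* S n k))) ⟩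
    √5 * fromℕ (fib k ℕ.* S n k) ∎

-- Enumeration of Fibonacci arrangements

concatMap-unique : {f : A → List B} {xs : List A} → Unique xs →
  (∀ {x} → x List.∈ xs → Unique (f x)) →
  (∀ {x y z} → x List.∈ xs → y List.∈ xs → z List.∈ f x → z List.∈ f y → x ≡ y) →
  Unique (concatMap f xs)
concatMap-unique [] _ _ = []
concatMap-unique {f = f} {x ∷ xs} (x∉xs ∷ xs!) f! f-disjoint = Unique.++⁺ (f! (here refl))
  (concatMap-unique xs! (f! ∘ there) (λ x∈ y∈ → f-disjoint (there x∈) (there y∈)))
  λ (z∈fx , z∈rest) → let (y , y∈xs , z∈fy) = find (List.∈-concatMap⁻ f z∈rest) in
    All.lookup x∉xs y∈xs (f-disjoint (here refl) (there y∈xs) z∈fx z∈fy)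

length-concatMap : (f : A → List B) → ∀ xs → length (concatMap f xs) ≡ ℕ.sum (map (length ∘ f) xs)
length-concatMap f []       = refl
length-concatMap f (x ∷ xs) =
  trans (List.length-++ (f x)) (cong (length (f x) ℕ.+_) (length-concatMap f xs))

sum-map-concatMap : (g : B → ℕ) (f : A → List B) → ∀ xs →
  ℕ.sum (map g (concatMap f xs)) ≡ ℕ.sum (map (ℕ.sum ∘ map g ∘ f) xs)
sum-map-concatMap g f []       = refl
sum-map-concatMap g f (x ∷ xs) = begin
  ℕ.sum (map g (f x ++ concatMap f xs))
    ≡⟨ cong ℕ.sum (List.map-++ g (f x) _) ⟩
  ℕ.sum (map g (f x) ++ map g (concatMap f xs))
    ≡⟨ sum-++ (map g (f x)) _ ⟩
  ℕ.sum (map g (f x)) ℕ.+ ℕ.sum (map g (concatMap f xs))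
    ≡⟨ cong (ℕ.sum (map g (f x)) ℕ.+_) (sum-map-concatMap g f xs) ⟩
  ℕ.sum (map (ℕ.sum ∘ map g ∘ f) (x ∷ xs)) ∎

sum-map-const : {f : A → ℕ} {c : ℕ} → ∀ xs → (∀ {x} → x List.∈ xs → f x ≡ c) → ℕ.sum (map f xs) ≡ length xs ℕ.* c
sum-map-const []       f≡c = refl
sum-map-const (x ∷ xs) f≡c = cong₂ ℕ._+_ (f≡c (here refl)) (sum-map-const xs (f≡c ∘ there))

-- Were the heads different, each would occur in the tail of the other list and the two would
-- precede each other. This recovers a partition from any arrangement of its blocks.
sorted-↭⇒≡ : {R : Rel A 0ℓ} → Asymmetric R → ∀ {xs ys} →
  AllPairs R xs → AllPairs R ys → xs ↭ ys → xs ≡ ys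
sorted-↭⇒≡ asym []         []         xs↭ys = refl
sorted-↭⇒≡ asym []         (_ ∷ _)    xs↭ys = contradiction (↭-sym xs↭ys) ¬x∷xs↭[]
sorted-↭⇒≡ asym (_ ∷ _)    []         xs↭ys = contradiction xs↭ys ¬x∷xs↭[]
sorted-↭⇒≡ asym (x< ∷ xs↗) (y< ∷ ys↗) xs↭ys
  with ∈-resp-↭ xs↭ys (here refl) | ∈-resp-↭ (↭-sym xs↭ys) (here refl)
... | here refl | _         = cong (_ ∷_) (sorted-↭⇒≡ asym xs↗ ys↗ (drop-∷ xs↭ys))
... | there _   | here refl = cong (_ ∷_) (sorted-↭⇒≡ asym xs↗ ys↗ (drop-∷ xs↭ys))
... | there x∈ys | there y∈xs = ⊥-elim (asym (All.lookup x< y∈xs) (All.lookup y< x∈ys))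

-- A Fibonacci permutation fixes the first position or exchanges the first two, and then acts
-- likewise on the rest.
arrangements : List A → List (List A)
arrangements []           = [ [] ]
arrangements (x ∷ [])     = [ [ x ] ]
arrangements (x ∷ y ∷ xs) =
  map (x ∷_) (arrangements (y ∷ xs)) ++ map (λ l → y ∷ x ∷ l) (arrangements xs)

length-arrangements : (xs : List A) → length (arrangements xs) ≡ fib (length xs)
length-arrangements []           = refl
length-arrangements (x ∷ [])     = refl
length-arrangements (x ∷ y ∷ xs) = trans (List.length-++ (map (x ∷_) (arrangements (y ∷ xs))))
  (cong₂ ℕ._+_ (trans (List.length-map _ (arrangements (y ∷ xs))) (length-arrangements (y ∷ xs)))
               (trans (List.length-map _ (arrangements xs)) (length-arrangements xs)))

arrangements-↭ : (xs : List A) → ∀ {l} → l List.∈ arrangements xs → l ↭ xs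
arrangements-↭ []           (here refl) = ↭.refl
arrangements-↭ (x ∷ [])     (here refl) = ↭.refl
arrangements-↭ (x ∷ y ∷ xs) l∈ with List.∈-++⁻ (map (x ∷_) (arrangements (y ∷ xs))) l∈
... | inj₁ l∈₁ with l′ , l′∈ , refl ← List.∈-map⁻ (x ∷_) l∈₁ = ↭.prep x (arrangements-↭ (y ∷ xs) l′∈)
... | inj₂ l∈₂ with l′ , l′∈ , refl ← List.∈-map⁻ (λ l → y ∷ x ∷ l) l∈₂ = ↭.swap y x (arrangements-↭ xs l′∈)

arrangements-unique : {xs : List A} → Unique xs → Unique (arrangements xs)
arrangements-unique []       = [] ∷ []
arrangements-unique (_ ∷ []) = [] ∷ []
arrangements-unique {xs = x ∷ y ∷ xs} ((x≢y ∷ _) ∷ yxs!@(_ ∷ xs!)) = Unique.++⁺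
  (Unique.map⁺ List.∷-injectiveʳ (arrangements-unique yxs!))
  (Unique.map⁺ (List.∷-injectiveʳ ∘ List.∷-injectiveʳ) (arrangements-unique xs!))
  -- Lists of the two kinds have different heads, `x` and `y`.
  λ (l∈₁ , l∈₂) → x≢y (List.∷-injectiveˡ (trans
    (sym (proj₂ (proj₂ (List.∈-map⁻ (x ∷_) l∈₁)))) (proj₂ (proj₂ (List.∈-map⁻ (λ l → y ∷ x ∷ l) l∈₂)))))

arrangements-sound : ∀ k (b : Fin k → A) {l} → l List.∈ arrangements (tabulate b) →
  Σ[ σ ∈ Permutation′ k ] IsFibonacciPermutation σ × l ≡ tabulate (b ∘ (σ ⟨$⟩ʳ_))
arrangements-sound 0 b (here refl) = Perm.id , (λ ()) , refl
arrangements-sound 1 b (here refl) = Perm.id , (λ { zero → z≤n }) , refl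
arrangements-sound (suc (suc k)) b l∈ with List.∈-++⁻ (map (b zero ∷_) (arrangements (tabulate (b ∘ suc)))) l∈
... | inj₁ l∈₁ with l′ , l′∈ , refl ← List.∈-map⁻ (b zero ∷_) l∈₁
               with σ , σ-fib , refl ← arrangements-sound (suc k) (b ∘ suc) l′∈
  = lift₀ σ , (λ { zero → z≤n ; (suc i) → σ-fib i }) , refl
... | inj₂ l∈₂ with l′ , l′∈ , refl ← List.∈-map⁻ (λ l → b (suc zero) ∷ b zero ∷ l) l∈₂
               with σ , σ-fib , refl ← arrangements-sound k (λ i → b (suc (suc i))) l′∈
  = Perm.swap σ , (λ { zero → s≤s z≤n ; (suc zero) → s≤s z≤n ; (suc (suc i)) → σ-fib i }) , refl

-- The value at 0 is 0 or 1. Removing the fixed point or the exchanged pair lowers the remaining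
-- positions and values equally, so their distances persist.
fibonacciPermutation-cases : ∀ {k} (σ : Permutation′ (suc (suc k))) → IsFibonacciPermutation σ →
  (Σ[ τ ∈ Permutation′ (suc k) ] IsFibonacciPermutation τ × lift₀ τ ≈ σ) ⊎
  (Σ[ τ ∈ Permutation′ k ] IsFibonacciPermutation τ × Perm.swap τ ≈ σ)
fibonacciPermutation-cases σ σ-fib with σ ⟨$⟩ʳ zero in σ0≡ | σ-fib zero
... | suc (suc _) | s≤s ()
... | zero | _ = inj₁ (remove zero σ , τ-fib , lift₀-remove σ σ0≡)
  where
  τ-fib : IsFibonacciPermutation (remove zero σ)
  τ-fib i = subst (λ j → ∣ toℕ j - toℕ (suc i) ∣ ℕ.≤ 1) (sym (lift₀-remove σ σ0≡ (suc i))) (σ-fib (suc i))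
... | suc zero | _ = inj₂ (τ , τ-fib , swap-τ)
  where
  -- Only the positions 0 and 1 can be sent to 0, and 0 is sent to 1.
  σ1≡ : σ ⟨$⟩ʳ suc zero ≡ zero
  σ1≡ with σ ⟨$⟩ˡ zero | inverseʳ σ {zero}
  ... | zero        | σ0≡0 = contradiction (trans (sym σ0≡) σ0≡0) λ ()
  ... | suc zero    | σ1≡0 = σ1≡0
  ... | suc (suc j) | σj≡0 with s≤s () ←
    subst (λ i → ∣ toℕ i - toℕ (suc (suc j)) ∣ ℕ.≤ 1) σj≡0 (σ-fib (suc (suc j)))
  -- Undoing the exchange first leaves two fixed points, which are removed one after the other.
  σ′ = transpose zero (suc zero) ∘ₚ σ
  ρ = remove zero σ′
  τ = remove zero ρ
  σ′-suc : ∀ i → suc (ρ ⟨$⟩ʳ i) ≡ σ′ ⟨$⟩ʳ suc i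
  σ′-suc i = lift₀-remove σ′ σ1≡ (suc i)
  ρ0≡ : ρ ⟨$⟩ʳ zero ≡ zero
  ρ0≡ = Fin.suc-injective (trans (σ′-suc zero) σ0≡)
  swap-τ : Perm.swap τ ≈ σ
  swap-τ zero          = sym σ0≡
  swap-τ (suc zero)    = sym σ1≡
  swap-τ (suc (suc i)) = trans (cong suc (lift₀-remove ρ ρ0≡ (suc i))) (σ′-suc (suc i))
  τ-fib : IsFibonacciPermutation τ
  τ-fib i = subst (λ j → ∣ toℕ j - toℕ (suc (suc i)) ∣ ℕ.≤ 1) (sym (swap-τ (suc (suc i)))) (σ-fib (suc (suc i)))

arrangements-complete : ∀ k (b : Fin k → A) (σ : Permutation′ k) → IsFibonacciPermutation σ →
  tabulate (b ∘ (σ ⟨$⟩ʳ_)) List.∈ arrangements (tabulate b)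
arrangements-complete 0 b σ σ-fib = here refl
arrangements-complete 1 b σ σ-fib with σ ⟨$⟩ʳ zero
... | zero = here refl
arrangements-complete {A} (suc (suc k)) b σ σ-fib =
  [ (λ (τ , τ-fib , τ≈σ) → List.∈-++⁺ˡ (permuted (lift₀ τ) τ≈σ
      (List.∈-map⁺ (b zero ∷_) (arrangements-complete (suc k) (b ∘ suc) τ τ-fib))))
  , (λ (τ , τ-fib , τ≈σ) → List.∈-++⁺ʳ (map (b zero ∷_) (arrangements (tabulate (b ∘ suc)))) (permuted (Perm.swap τ) τ≈σ
      (List.∈-map⁺ (λ l → b (suc zero) ∷ b zero ∷ l) (arrangements-complete k (λ i → b (suc (suc i))) τ τ-fib))))
  ]′ (fibonacciPermutation-cases σ σ-fib)
  where
  -- The case distinction gives `σ` only up to pointwise equality, which is all that a tabulation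
  -- sees.
  permuted : ∀ (ρ : Permutation′ (suc (suc k))) {ls} → ρ ≈ σ →
    tabulate (b ∘ (ρ ⟨$⟩ʳ_)) List.∈ ls → tabulate (b ∘ (σ ⟨$⟩ʳ_)) List.∈ ls
  permuted ρ {ls} ρ≈σ = subst (List._∈ ls) (List.tabulate-cong (cong b ∘ ρ≈σ))

-- Enumeration of set partitions

-- For non-empty blocks this says min b < min c.
infix 4 _≺_
_≺_ : Subset n → Subset n → Set
b ≺ c = ∃[ x ] x ∈ b × (∀ {y} → y ∈ c → x Fin.< y)

≺-asym : Asymmetric (_≺_ {n})
≺-asym (x , x∈b , x<c) (y , y∈c , y<b) = Fin.<-asym (x<c y∈c) (y<b x∈b)

-- The blocks with index below m already contain elements smaller than those
-- of Fin n: they may be empty here, and their order is not constrained.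
record IsPartition (m : ℕ) (b : Fin k → Subset n) : Set where
  field
    m≤k      : m ℕ.≤ k
    nonempty : ∀ i → m ℕ.≤ toℕ i → Nonempty (b i)
    disjoint : ∀ {i j x} → x ∈ b i → x ∈ b j → i ≡ j
    covering : ∀ x → ∃[ i ] x ∈ b i
    ordered  : ∀ {i j} → m ℕ.≤ toℕ i → i Fin.< j → b i ≺ b j

least : (b : Subset n) → Nonempty b → ∃[ x ] IsLeast x b
least (inside  ∷ b) _                  = zero , here , λ _ → z≤n
least (outside ∷ b) (suc x , there x∈b) =
  let (y , y∈b , y≤) = least b (x , x∈b) in suc y , there y∈b , λ { (there z∈b) → s≤s (y≤ z∈b) }

fromIsSetPartition : {b : Fin k → Subset n} → IsSetPartition b → IsPartition 0 b
fromIsSetPartition {b = b} p = record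
  { m≤k      = z≤n
  ; nonempty = λ i _ → P.nonempty i
  ; disjoint = P.disjoint
  ; covering = P.covering
  ; ordered  = λ {i} {j} _ i<j →
      let (x , x-least) = least (b i) (P.nonempty i)
          (y , y-least) = least (b j) (P.nonempty j)
      in x , proj₁ x-least , λ z∈bⱼ → ℕ.<-≤-trans (P.ordered i<j x-least y-least) (proj₂ y-least z∈bⱼ)
  }
  where module P = IsSetPartition p

toIsSetPartition : {b : Fin k → Subset n} → IsPartition 0 b → IsSetPartition b
toIsSetPartition p = record
  { nonempty = λ i → P.nonempty i z≤n
  ; disjoint = P.disjoint
  ; covering = P.covering
  ; ordered  = λ i<j (_ , x≤) (y∈bⱼ , _) →
      let (_ , z∈bᵢ , z<) = P.ordered z≤n i<j in ℕ.≤-<-trans (x≤ z∈bᵢ) (z< y∈bⱼ)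
  }
  where module P = IsPartition p

-- Old elements move up by one to make room for a new least element. The index is a natural number
-- so that lists and families of any size can share it.
addZero : ℕ → (Fin k → Subset n) → Fin k → Subset (suc n)
addZero i b j = (toℕ j ≡ᵇ i) ∷ b j

zero∈addZero⁺ : ∀ {i} (b : Fin k → Subset n) j → toℕ j ≡ i → zero ∈ addZero i b j
zero∈addZero⁺ {i = i} b j j≡i rewrite dec-true (toℕ j ℕ.≟ i) j≡i = here

zero∈addZero⁻ : ∀ {i} (b : Fin k → Subset n) j → zero ∈ addZero i b j → toℕ j ≡ i
zero∈addZero⁻ {i = i} b j zero∈ with toℕ j ℕ.≟ i
... | yes j≡i = j≡i
... | no  j≢i rewrite dec-false (toℕ j ℕ.≟ i) j≢i with () ← zero∈

-- By disjointness no block other than `b i` contains zero, so the deleted head bits can be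
-- reconstructed.
addZero-tail : {b : Fin k → Subset (suc n)} → IsPartition m b → ∀ {i} → zero ∈ b i →
  addZero (toℕ i) (tail ∘ b) ≗ b
addZero-tail {b = b} p {i} zero∈bᵢ j with b j in bⱼ≡
... | inside  ∷ c = cong (_∷ c) (dec-true (toℕ j ℕ.≟ toℕ i)
  (cong toℕ (IsPartition.disjoint p (subst (zero ∈_) (sym bⱼ≡) here) zero∈bᵢ)))
... | outside ∷ c = cong (_∷ c) (dec-false (toℕ j ℕ.≟ toℕ i) λ j≡i →
  contradiction (subst (zero ∈_) (trans (cong b (sym (Fin.toℕ-injective j≡i))) bⱼ≡) zero∈bᵢ) λ ())

∈-tail⁺ : ∀ {x} (b : Subset (suc n)) → suc x ∈ b → x ∈ tail b
∈-tail⁺ (_ ∷ _) (there x∈b) = x∈b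

∈-tail⁻ : ∀ {x} (b : Subset (suc n)) → x ∈ tail b → suc x ∈ b
∈-tail⁻ (_ ∷ _) x∈b = there x∈b

-- If `i` is `m`, block `i` may be empty and unordered in `b`: zero makes it non-empty and puts its
-- minimum before all later blocks. If `i` is smaller, the open blocks stay the same.
IsPartition-addZero : ∀ {i} {b : Fin k → Subset n} → i ℕ.≤ m →
  IsPartition (m ⊔ suc i) b → IsPartition m (addZero i b)
IsPartition-addZero {k} {n} {m} {i} {b} i≤m p = record
  { m≤k      = ℕ.≤-trans (ℕ.m≤m⊔n m (suc i)) P.m≤k
  ; nonempty = nonempty
  ; disjoint = disjoint
  ; covering = λ
      { zero    → fromℕ< i<k , zero∈addZero⁺ b (fromℕ< i<k) (Fin.toℕ-fromℕ< i<k)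
      ; (suc x) → let (j , x∈bⱼ) = P.covering x in j , there x∈bⱼ
      }
  ; ordered  = ordered
  }
  where
  module P = IsPartition p
  i<k : i ℕ.< k
  i<k = ℕ.≤-trans (ℕ.m≤n⊔m m (suc i)) P.m≤k
  -- As `i ≤ m`, an index from `m` on that differs from `i` lies beyond `i`.
  later : ∀ {j} → m ℕ.≤ j → ¬ j ≡ i → m ⊔ suc i ℕ.≤ j
  later m≤j j≢i = ℕ.⊔-lub m≤j (ℕ.≤∧≢⇒< (ℕ.≤-trans i≤m m≤j) (j≢i ∘ sym))
  nonempty : ∀ j → m ℕ.≤ toℕ j → Nonempty (addZero i b j)
  nonempty j m≤j with toℕ j ℕ.≟ i
  ... | yes j≡i = zero , zero∈addZero⁺ b j j≡i
  ... | no  j≢i = let (x , x∈bⱼ) = P.nonempty j (later m≤j j≢i) in suc x , there x∈bⱼ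
  disjoint : ∀ {j l x} → x ∈ addZero i b j → x ∈ addZero i b l → j ≡ l
  disjoint {j} {l} {zero}  x∈bⱼ x∈bₗ =
    Fin.toℕ-injective (trans (zero∈addZero⁻ b j x∈bⱼ) (sym (zero∈addZero⁻ b l x∈bₗ)))
  disjoint {x = suc x} (there x∈bⱼ) (there x∈bₗ) = P.disjoint x∈bⱼ x∈bₗ
  zero∉ : ∀ {j l} → m ℕ.≤ toℕ j → j Fin.< l → ¬ zero ∈ addZero i b l
  zero∉ {l = l} m≤j j<l zero∈ = ℕ.<⇒≱ j<l
    (ℕ.≤-trans (ℕ.≤-reflexive (zero∈addZero⁻ b l zero∈)) (ℕ.≤-trans i≤m m≤j))
  ordered : ∀ {j l} → m ℕ.≤ toℕ j → j Fin.< l → addZero i b j ≺ addZero i b l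
  ordered {j} {l} m≤j j<l with toℕ j ℕ.≟ i
  ... | yes j≡i = zero , zero∈addZero⁺ b j j≡i , λ
    { {zero} zero∈ → ⊥-elim (zero∉ m≤j j<l zero∈) ; {suc _} _ → s≤s z≤n }
  ... | no  j≢i = let (x , x∈bⱼ , x<) = P.ordered (later m≤j j≢i) j<l in
    suc x , there x∈bⱼ , λ
    { {zero} zero∈ → ⊥-elim (zero∉ m≤j j<l zero∈) ; {suc _} (there y∈bₗ) → s≤s (x< y∈bₗ) }

-- Otherwise block `m` would come earlier and have to contain an element below zero.
zero∈⇒≤ : {b : Fin k → Subset (suc n)} → IsPartition m b → ∀ {i} → zero ∈ b i → toℕ i ℕ.≤ m
zero∈⇒≤ {k} {m = m} {b = b} p {i} zero∈bᵢ = ℕ.≮⇒≥ λ m<i →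
  let m<k = ℕ.<-trans m<i (Fin.toℕ<n i)
      m≡  = Fin.toℕ-fromℕ< m<k
      (_ , _ , x<) = IsPartition.ordered p {fromℕ< m<k} {i} (ℕ.≤-reflexive (sym m≡))
                       (subst (ℕ._< toℕ i) (sym m≡) m<i)
  in contradiction (x< zero∈bᵢ) λ ()

-- Blocks with index at least `m ⊔ suc (toℕ i)` do not contain zero, so its removal keeps their
-- elements and their order.
IsPartition-tail : {b : Fin k → Subset (suc n)} → IsPartition m b → ∀ {i} → zero ∈ b i →
  IsPartition (m ⊔ suc (toℕ i)) (tail ∘ b)
IsPartition-tail {k} {n} {m} {b} p {i} zero∈bᵢ = record
  { m≤k      = ℕ.⊔-lub P.m≤k (Fin.toℕ<n i)
  ; nonempty = nonempty
  ; disjoint = λ {j} {l} x∈bⱼ x∈bₗ → P.disjoint (∈-tail⁻ (b j) x∈bⱼ) (∈-tail⁻ (b l) x∈bₗ)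
  ; covering = λ x → let (j , x∈bⱼ) = P.covering (suc x) in j , ∈-tail⁺ (b j) x∈bⱼ
  ; ordered  = ordered
  }
  where
  module P = IsPartition p
  zero∉ : ∀ {j} → m ⊔ suc (toℕ i) ℕ.≤ toℕ j → ¬ zero ∈ b j
  zero∉ {j} ≤j zero∈bⱼ = ℕ.<-irrefl (cong toℕ (P.disjoint zero∈bᵢ zero∈bⱼ)) (ℕ.m⊔n≤o⇒n≤o m (suc (toℕ i)) ≤j)
  nonempty : ∀ j → m ⊔ suc (toℕ i) ℕ.≤ toℕ j → Nonempty (tail (b j))
  nonempty j ≤j with P.nonempty j (ℕ.m⊔n≤o⇒m≤o m (suc (toℕ i)) ≤j)
  ... | zero  , zero∈bⱼ = ⊥-elim (zero∉ ≤j zero∈bⱼ)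
  ... | suc x , x∈bⱼ    = x , ∈-tail⁺ (b j) x∈bⱼ
  ordered : ∀ {j l} → m ⊔ suc (toℕ i) ℕ.≤ toℕ j → j Fin.< l → tail (b j) ≺ tail (b l)
  ordered {j} {l} ≤j j<l with P.ordered (ℕ.m⊔n≤o⇒m≤o m (suc (toℕ i)) ≤j) j<l
  ... | zero  , zero∈bⱼ , _ = ⊥-elim (zero∉ ≤j zero∈bⱼ)
  ... | suc x , x∈bⱼ , x<   = x , ∈-tail⁺ (b j) x∈bⱼ , λ y∈bₗ → ℕ.s<s⁻¹ (x< (∈-tail⁻ (b l) y∈bₗ))

-- Listing the set partitions

placeZero : ℕ → List (Subset n) → List (Subset (suc n))
placeZero _       []       = []
placeZero zero    (b ∷ bs) = (inside ∷ b) ∷ map (outside ∷_) bs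
placeZero (suc i) (b ∷ bs) = (outside ∷ b) ∷ placeZero i bs

placeZero-tabulate : ∀ i k (b : Fin k → Subset n) → placeZero i (tabulate b) ≡ tabulate (addZero i b)
placeZero-tabulate i       zero    b = refl
placeZero-tabulate zero    (suc k) b = cong ((inside ∷ b zero) ∷_) (List.map-tabulate (b ∘ suc) (outside ∷_))
placeZero-tabulate (suc i) (suc k) b = cong ((outside ∷ b zero) ∷_) (placeZero-tabulate i k (b ∘ suc))

length-placeZero : ∀ i (bs : List (Subset n)) → length (placeZero i bs) ≡ length bs
length-placeZero i       []       = refl
length-placeZero zero    (b ∷ bs) = cong suc (List.length-map (outside ∷_) bs)
length-placeZero (suc i) (b ∷ bs) = cong suc (length-placeZero i bs)

map-tail-placeZero : ∀ i (bs : List (Subset n)) → map tail (placeZero i bs) ≡ bs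
map-tail-placeZero i       []       = refl
map-tail-placeZero zero    (b ∷ bs) = cong (b ∷_) (trans (sym (List.map-∘ bs)) (List.map-id bs))
map-tail-placeZero (suc i) (b ∷ bs) = cong (b ∷_) (map-tail-placeZero i bs)

placeZero-injective : ∀ i {bs cs : List (Subset n)} → placeZero i bs ≡ placeZero i cs → bs ≡ cs
placeZero-injective i {bs} {cs} eq =
  trans (sym (map-tail-placeZero i bs)) (trans (cong (map tail) eq) (map-tail-placeZero i cs))

-- Reads off where zero was placed, so that different choices give different lists; the value at the
-- empty list is a dummy.
indexOfZero : List (Subset (suc n)) → ℕ
indexOfZero []                   = 0
indexOfZero ((inside  ∷ _) ∷ bs) = 0
indexOfZero ((outside ∷ _) ∷ bs) = suc (indexOfZero bs)

indexOfZero-placeZero : ∀ i (bs : List (Subset n)) → i ℕ.< length bs → indexOfZero (placeZero i bs) ≡ i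
indexOfZero-placeZero zero    (b ∷ bs) _        = refl
indexOfZero-placeZero (suc i) (b ∷ bs) (s≤s i<) = cong suc (indexOfZero-placeZero i bs i<)

-- The smallest element goes to an opened block (i < m) or opens the block
-- with index i = m; afterwards m ⊔ suc i blocks are open.
partitions : ∀ n → ℕ → List (List (Subset n))
partitions zero    m = [ replicate m [] ]
partitions (suc n) m = concatMap (λ i → map (placeZero i) (partitions n (m ⊔ suc i))) (upTo (suc m))

partitions-sound : ∀ n m {bs} → bs List.∈ partitions n m →
  ∃[ k ] Σ[ b ∈ (Fin k → Subset n) ] IsPartition m b × bs ≡ tabulate b
-- With no element left, exactly the `m` open blocks exist and the conditions on later indices are
-- vacuous.
partitions-sound zero m (here refl) = m , (λ _ → []) , record
  { m≤k      = ℕ.≤-refl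
  ; nonempty = λ i m≤i → contradiction m≤i (ℕ.<⇒≱ (Fin.toℕ<n i))
  ; disjoint = λ ()
  ; covering = λ ()
  ; ordered  = λ {i} m≤i _ → contradiction m≤i (ℕ.<⇒≱ (Fin.toℕ<n i))
  } , replicate≡tabulate m
  where
  replicate≡tabulate : ∀ m → replicate m [] ≡ tabulate {n = m} (λ _ → [])
  replicate≡tabulate zero    = refl
  replicate≡tabulate (suc m) = cong ([] ∷_) (replicate≡tabulate m)
partitions-sound (suc n) m bs∈
  with i , i∈ , bs∈ᵢ ← find (List.∈-concatMap⁻ (λ i → map (placeZero i) (partitions n (m ⊔ suc i))) bs∈)
  with cs , cs∈ , refl ← List.∈-map⁻ (placeZero i) bs∈ᵢ
  with k , b , p , refl ← partitions-sound n (m ⊔ suc i) cs∈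
  = k , addZero i b , IsPartition-addZero (ℕ.s≤s⁻¹ (List.∈-upTo⁻ i∈)) p , placeZero-tabulate i k b

-- The block that contains zero dictates the choice of `i`; deleting zero reduces to the recursive
-- call, and placing it again restores the blocks.
partitions-complete : ∀ n m {k} {b : Fin k → Subset n} → IsPartition m b → tabulate b List.∈ partitions n m
partitions-complete zero m {k} {b} p = here (tabulate≡replicate k≡m b)
  where
  k≡m : k ≡ m
  -- A block with index `m` would need an element of `Fin 0`.
  k≡m = ℕ.≤-antisym (ℕ.≮⇒≥ λ m<k → contradiction
    (proj₁ (IsPartition.nonempty p (fromℕ< m<k) (ℕ.≤-reflexive (sym (Fin.toℕ-fromℕ< m<k))))) λ ())
    (IsPartition.m≤k p)
  tabulate≡replicate : ∀ {k m} → k ≡ m → (b : Fin k → Subset 0) → tabulate b ≡ replicate m []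
  tabulate≡replicate {zero}  refl b = refl
  tabulate≡replicate {suc k} refl b with [] ← b zero = cong ([] ∷_) (tabulate≡replicate refl (b ∘ suc))
partitions-complete (suc n) m {k} {b} p with i , zero∈bᵢ ← IsPartition.covering p zero =
  List.∈-concatMap⁺ (λ i → map (placeZero i) (partitions n (m ⊔ suc i)))
    (lose (List.∈-upTo⁺ (s≤s (zero∈⇒≤ p zero∈bᵢ)))
      (subst (List._∈ map (placeZero (toℕ i)) (partitions n (m ⊔ suc (toℕ i))))
        (trans (placeZero-tabulate (toℕ i) k (tail ∘ b)) (List.tabulate-cong (addZero-tail p zero∈bᵢ)))
        (List.∈-map⁺ (placeZero (toℕ i)) (partitions-complete n (m ⊔ suc (toℕ i)) (IsPartition-tail p zero∈bᵢ)))))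

partitions-unique : ∀ n m → Unique (partitions n m)
partitions-unique zero    m = [] ∷ []
partitions-unique (suc n) m = concatMap-unique (Unique.upTo⁺ (suc m))
  (λ {i} _ → Unique.map⁺ (placeZero-injective i) (partitions-unique n (m ⊔ suc i)))
  λ {i} {j} _ _ bs∈ᵢ bs∈ⱼ → trans (sym (index i bs∈ᵢ)) (index j bs∈ⱼ)
  where
  index : ∀ i {bs} → bs List.∈ map (placeZero i) (partitions n (m ⊔ suc i)) → indexOfZero bs ≡ i
  index i bs∈ with cs , cs∈ , refl ← List.∈-map⁻ (placeZero i) bs∈
              with k , b , p , refl ← partitions-sound n (m ⊔ suc i) cs∈
    -- Zero is really placed: by `m≤k` there are at least `m ⊔ suc i` blocks, hence one with index
    -- `i`.
    = indexOfZero-placeZero i (tabulate b) (subst (i ℕ.<_) (sym (List.length-tabulate b))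
        (ℕ.≤-trans (ℕ.m≤n⊔m m (suc i)) (IsPartition.m≤k p)))

-- The `m` choices `i < m` keep `m` blocks open and contribute equal terms, while `i = m` opens one
-- more; together they form one application of `L`.
sum-partitions : ∀ φ n m → ℕ.sum (map (φ ∘ length) (partitions n m)) ≡ L^ n φ m
sum-partitions φ zero    m = trans (ℕ.+-identityʳ _) (cong φ (List.length-replicate m))
sum-partitions φ (suc n) m = begin
  ℕ.sum (map (φ ∘ length) (partitions (suc n) m))
    ≡⟨ sum-map-concatMap (φ ∘ length) (λ i → map (placeZero i) (partitions n (m ⊔ suc i))) (upTo (suc m)) ⟩
  ℕ.sum (map (λ i → ℕ.sum (map (φ ∘ length) (map (placeZero i) (partitions n (m ⊔ suc i))))) (upTo (suc m)))
    ≡⟨ cong ℕ.sum (List.map-cong step (upTo (suc m))) ⟩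
  ℕ.sum (map h (upTo (suc m)))
    ≡⟨ cong (ℕ.sum ∘ map h) (List.upTo-∷ʳ m) ⟨
  ℕ.sum (map h (upTo m List.∷ʳ m))
    ≡⟨ cong ℕ.sum (List.map-++ h (upTo m) [ m ]) ⟩
  ℕ.sum (map h (upTo m) ++ [ h m ])
    ≡⟨ sum-++ (map h (upTo m)) [ h m ] ⟩
  ℕ.sum (map h (upTo m)) ℕ.+ (h m ℕ.+ 0)
    ≡⟨ cong₂ ℕ._+_ (sum-map-const (upTo m) λ i∈ → cong (L^ n φ) (ℕ.m≥n⇒m⊔n≡m (List.∈-upTo⁻ i∈))) (ℕ.+-identityʳ (h m)) ⟩
  length (upTo m) ℕ.* L^ n φ m ℕ.+ h m
    ≡⟨ cong₂ (λ l o → l ℕ.* L^ n φ m ℕ.+ L^ n φ o) (List.length-upTo m) (ℕ.m≤n⇒m⊔n≡n (ℕ.n≤1+n m)) ⟩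
  m ℕ.* L^ n φ m ℕ.+ L^ n φ (suc m) ∎
  where
  h : ℕ → ℕ
  h i = L^ n φ (m ⊔ suc i)
  step : ∀ i → ℕ.sum (map (φ ∘ length) (map (placeZero i) (partitions n (m ⊔ suc i)))) ≡ h i
  step i = begin
    ℕ.sum (map (φ ∘ length) (map (placeZero i) (partitions n (m ⊔ suc i))))
      ≡⟨ cong ℕ.sum (List.map-∘ (partitions n (m ⊔ suc i))) ⟨
    ℕ.sum (map (φ ∘ length ∘ placeZero i) (partitions n (m ⊔ suc i)))
      ≡⟨ cong ℕ.sum (List.map-cong (cong φ ∘ length-placeZero i) (partitions n (m ⊔ suc i))) ⟩
    ℕ.sum (map (φ ∘ length) (partitions n (m ⊔ suc i)))
      ≡⟨ sum-partitions φ n (m ⊔ suc i) ⟩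
    h i ∎

partitions-sorted : ∀ {bs} → bs List.∈ partitions n 0 → AllPairs _≺_ bs
partitions-sorted {n} bs∈ with k , b , p , refl ← partitions-sound n 0 bs∈ =
  AllPairs.tabulate⁺-< (IsPartition.ordered p z≤n)

-- Counting Fibonacci ordered partitions

isFibonacciFubini : ∀ n → IsFibonacciFubini n (L^ n fib 0)
isFibonacciFubini n = concatMap arrangements (partitions n 0) , unique , (λ π → mk⇔ sound complete) , count
  where
  unique : Unique (concatMap arrangements (partitions n 0))
  unique = concatMap-unique (partitions-unique n 0)
    -- Asymmetry makes `_≺_` irreflexive, so the blocks of a partition are distinct.
    (λ bs∈ → arrangements-unique (AllPairs.map (λ { b≺c refl → ≺-asym b≺c b≺c }) (partitions-sorted bs∈)))
    -- A common arrangement makes `bs` and `cs` rearrangements of each other, and both are sorted.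
    λ {bs} {cs} bs∈ cs∈ l∈bs l∈cs → sorted-↭⇒≡ ≺-asym (partitions-sorted bs∈) (partitions-sorted cs∈)
      (↭-trans (↭-sym (arrangements-↭ bs l∈bs)) (arrangements-↭ cs l∈cs))

  sound : ∀ {π} → π List.∈ concatMap arrangements (partitions n 0) → IsFibonacciOrderedPartition n π
  sound π∈ with bs , bs∈ , π∈bs ← find (List.∈-concatMap⁻ arrangements π∈)
           with k , b , p , refl ← partitions-sound n 0 bs∈
           with σ , σ-fib , π≡ ← arrangements-sound k b π∈bs
    = k , b , σ , toIsSetPartition p , σ-fib , π≡

  complete : ∀ {π} → IsFibonacciOrderedPartition n π → π List.∈ concatMap arrangements (partitions n 0)
  complete (k , b , σ , p , σ-fib , refl) = List.∈-concatMap⁺ arrangements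
    (lose (partitions-complete n 0 (fromIsSetPartition p)) (arrangements-complete k b σ σ-fib))

  count : length (concatMap arrangements (partitions n 0)) ≡ L^ n fib 0
  count = trans (length-concatMap arrangements (partitions n 0))
    (trans (cong ℕ.sum (List.map-cong length-arrangements (partitions n 0))) (sum-partitions fib n 0))

theorem1 : ∀ (n : ℕ) → ∃[ 𝓕ₙ ] IsFibonacciFubini n 𝓕ₙ ×
    fromℕ 𝓕ₙ ≡ √5 ⁻¹ * (∑[ k ≤ n ] ∑[ j ≤ k ]
    ((- 1#) ^ (k ∸ j) * fromℕ (k C j) * ((α ^ suc k - β ^ suc k) / (k !)) {{k !≢0}} * fromℕ j ^ n))
theorem1 n = L^ n fib 0 , isFibonacciFubini n ,
  sym (trans (explicit-formula n) (cong fromℕ (∑S≡L^ n fib)))
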